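{- Let $\kappa$ be any infinite cardinal. Then there is a partition $[\kappa]^{<\omega}=A_0\cup A_1$ into two cells such that for no $i\in 2$ and no uncountable family $X\subseteq[\kappa]^{<\omega}$ of pairwise disjoint finite subsets of $\kappa$ do we have $\mathrm{FU}(X)\subseteq A_i$. Consequently, for every uncountable cardinal $\lambda$ and every cardinal $\kappa\geq\lambda$, the statement $\mathrm{Hind}(\kappa,\lambda)$ fails.
   Context: $[\kappa]^{<\omega}$ denotes the family of all finite subsets of $\kappa$. For a family $X$ of sets, $\mathrm{FU}(X)=\{\bigcup_{Y\in F}Y : F\subseteq X \text{ finite and nonempty}\}$ is the set of finite unions of elements of $X$. For cardinals $\lambda\leq\kappa$, $\mathrm{Hind}(\kappa,\lambda)$ is the statement: for every partition $[\kappa]^{<\omega}=A_0\cup A_1$ into two cells there exist a family $X\subseteq[\kappa]^{<\omega}$ of cardinality $\lambda$ consisting of pairwise disjoint finite subsets of $\kappa$, and an $i\in 2$, such that $\mathrm{FU}(X)\subseteq A_i$. -}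

module Defs where

open import Data.Fin.Base using (Fin)
open import Data.List.Relation.Unary.Enumerates.Setoid using (IsEnumeration)
import Data.List.Membership.Setoid as Membership
open import Data.Nat.Base using (ℕ)
open import Data.Product.Base using (Σ-syntax; ∃-syntax; _×_; proj₁)
open import Function.Bundles using (Injection; Bijection; _⇔_)
open import Induction.WellFounded using (WellFounded)
open import Level using (Level; _⊔_) renaming (suc to lsuc)
open import Relation.Binary.Bundles using (Setoid)
open import Relation.Binary.Core using (Rel)
open import Relation.Binary.Definitions using (_Respects_)
open import Relation.Binary.PropositionalEquality using (_≡_; setoid)
open import Relation.Binary.Structures using (IsStrictTotalOrder)
import Relation.Binary.Construct.On as On
open import Relation.Nullary.Negation using (¬_)
open import Relation.Unary using (Pred; _∈_; _⊆_; _⊥_; Satisfiable)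
open import Relation.Unary.Relation.Binary.Equality using (≐-setoid)

private
  variable
    a e p ℓ : Level

infix 8 _↾_
_↾_ : (S : Setoid a e) → Pred (Setoid.Carrier S) p → Setoid (a ⊔ p) e
S ↾ P = On.setoid S (proj₁ {B = P})

Finite : (S : Setoid a e) → Pred (Setoid.Carrier S) p → Set (a ⊔ e ⊔ p)
Finite S P = ∃[ xs ] (∀ x → x ∈ P ⇔ x ∈ₛ xs)
  where open Membership S renaming (_∈_ to _∈ₛ_)

Infinite : Setoid a e → Set (a ⊔ e)
Infinite S = ¬ (∃[ xs ] IsEnumeration S xs)

Countable : Setoid a e → Set (a ⊔ e)
Countable S = Injection S (setoid ℕ)

Uncountable : Setoid a e → Set (a ⊔ e)
Uncountable S = ¬ Countable S

-- Cardinals are initial ordinals: well-ordered types that are not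
-- equinumerous with any of their proper initial segments.
record Cardinal (ℓ : Level) : Set (lsuc ℓ) where
  field
    Carrier            : Set ℓ
    _<_                : Rel Carrier ℓ
    isStrictTotalOrder : IsStrictTotalOrder _≡_ _<_
    wellFounded        : WellFounded _<_
    initial            : ∀ α → ¬ Bijection (setoid Carrier) (setoid Carrier ↾ (_< α))

∣_∣ : Cardinal ℓ → Setoid ℓ ℓ
∣ κ ∣ = setoid (Cardinal.Carrier κ)

infix 4 _≤ᶜ_
_≤ᶜ_ : Cardinal ℓ → Cardinal ℓ → Set ℓ
μ ≤ᶜ κ = Injection ∣ μ ∣ ∣ κ ∣

record FinSubset (κ : Cardinal ℓ) : Set (lsuc ℓ) where
  field
    elements : Pred (Cardinal.Carrier κ) ℓ
    finite   : Finite ∣ κ ∣ elements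

open FinSubset public using (elements)

-- The equality of finite subsets is extensional: it ignores the enumeration
-- witnessing finiteness.
[_]^<ω : Cardinal ℓ → Setoid (lsuc ℓ) ℓ
[ κ ]^<ω = On.setoid (≐-setoid (Cardinal.Carrier κ) _) (elements {κ = κ})

-- Subsets of [κ]^<ω are the predicates invariant under extensional equality.
record Family (κ : Cardinal ℓ) : Set (lsuc (lsuc ℓ)) where
  field
    members  : Pred (FinSubset κ) (lsuc ℓ)
    respects : members Respects (Setoid._≈_ [ κ ]^<ω)

open Family public using (members)

⟦_⟧ : {κ : Cardinal ℓ} → Family κ → Setoid (lsuc ℓ) ℓ
⟦_⟧ {κ = κ} X = [ κ ]^<ω ↾ members X

PairwiseDisjoint : {κ : Cardinal ℓ} → Family κ → Set (lsuc ℓ)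
PairwiseDisjoint {κ = κ} X =
  ∀ Y Z → Y ∈ members X → Z ∈ members X → ¬ (Y ≈ Z) → elements Y ⊥ elements Z
  where open Setoid [ κ ]^<ω using (_≈_)

FU : {κ : Cardinal ℓ} → Family κ → Pred (FinSubset κ) (lsuc (lsuc ℓ))
FU {κ = κ} X S =
  Σ[ F ∈ Family κ ]
    members F ⊆ members X ×
    Finite [ κ ]^<ω (members F) ×
    Satisfiable (members F) ×
    (∀ α → α ∈ elements S ⇔ (∃[ Y ] Y ∈ members F × α ∈ elements Y))

-- As usual for colourings, a cell may be empty.
record Partition (κ : Cardinal ℓ) : Set (lsuc (lsuc ℓ)) where
  field
    cell     : Fin 2 → Family κ
    covers   : ∀ S → ∃[ i ] S ∈ members (cell i)
    disjoint : ∀ i j S → S ∈ members (cell i) → S ∈ members (cell j) → i ≡ j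

open Partition public using (cell)

Hind : Cardinal ℓ → Cardinal ℓ → Set (lsuc (lsuc ℓ))
Hind κ μ =
  (A : Partition κ) →
  Σ[ X ∈ Family κ ]
    Bijection ∣ μ ∣ ⟦ X ⟧ ×
    PairwiseDisjoint X ×
    (∃[ i ] FU X ⊆ members (cell A i))

{-# OPTIONS --safe #-}
-- Colour a finite set S by the parity of ⌊log₂ |S|⌋.  If Y and Z are disjoint
-- and have the same size n > 0, then |Y ∪ Z| = 2n, so Y and Y ∪ Z get different
-- colours.  Hence on a pairwise disjoint family X with FU(X) monochromatic the
-- size is injective, and X is countable.
module Submission where

open import Defs
open import Data.Fin.Base using (Fin; zero; suc; opposite)
open import Data.List.Base using (List; []; _∷_; _++_; deduplicate; length)
open import Data.List.Membership.Propositional using () renaming (_∈_ to _∈ₗ_)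
open import Data.List.Membership.Propositional.Properties using (∈-++⁺ˡ; ∈-++⁺ʳ; ∈-++⁻; deduplicate-∈⇔)
open import Data.List.Membership.Propositional.Properties.WithK using (unique∧set⇒bag)
open import Data.List.Properties using (length-++)
open import Data.List.Relation.Binary.BagAndSetEquality using (∼bag⇒↭)
open import Data.List.Relation.Binary.Permutation.Propositional.Properties using (↭-length)
import Data.List.Relation.Binary.Subset.DecPropositional as DecSubset
open import Data.List.Relation.Unary.Any using (here; there)
open import Data.List.Relation.Unary.Unique.Propositional using (Unique)
open import Data.List.Relation.Unary.Unique.Propositional.Properties using (++⁺)
import Data.List.Relation.Unary.Unique.DecPropositional.Properties as DecUnique
open import Data.Nat.Base using (ℕ; zero; suc; _+_; _*_; NonZero; ≢-nonZero)
open import Data.Nat.Logarithm using (⌊log₂_⌋; ⌊log₂[2*b]⌋≡1+⌊log₂b⌋)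
open import Data.Nat.Properties using (+-identityʳ)
open import Data.Product.Base using (Σ-syntax; _×_; _,_; proj₁; proj₂)
open import Data.Sum.Base using (_⊎_; inj₁; inj₂; [_,_]; map)
open import Function.Base using (_∘_)
open import Function.Bundles using (Bijection; Equivalence; _⇔_; mk⇔)
open import Function.Construct.Composition using (_⇔-∘_; injection)
open import Function.Construct.Symmetry using (⇔-sym)
open import Level using (Level; Lift; lift; lower)
open import Relation.Binary.Bundles using (Setoid)
open import Relation.Binary.PropositionalEquality using (_≡_; _≢_; refl; sym; trans; cong; module ≡-Reasoning)
open import Relation.Binary.Structures using (IsStrictTotalOrder)
open import Relation.Nullary.Decidable using (Dec; _×-dec_; map′; decidable-stable)
open import Relation.Binary.Definitions using (Decidable)
open import Relation.Nullary.Negation using (¬_)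
open import Relation.Unary using (_∈_; _⊆_; _⊥_; _∪_)

open Equivalence using (to; from)

private
  variable
    a ℓ : Level
    A : Set a

-- Repetition-free lists with the same members agree as bags, so each is a permutation of the other.
-- This makes cardinality independent of the chosen enumeration.
unique-length-≡ : {xs ys : List A} → Unique xs → Unique ys →
                  (∀ {x} → x ∈ₗ xs ⇔ x ∈ₗ ys) → length xs ≡ length ys
unique-length-≡ xs! ys! xs⇔ys = ↭-length (∼bag⇒↭ (unique∧set⇒bag xs! ys! xs⇔ys))

parity₂ : ℕ → Fin 2
parity₂ zero    = zero
parity₂ (suc n) = opposite (parity₂ n)

opposite₂-≢ : (i : Fin 2) → opposite i ≢ i
opposite₂-≢ zero       ()
opposite₂-≢ (suc zero) ()

colourℕ : ℕ → Fin 2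
colourℕ n = parity₂ ⌊log₂ n ⌋

-- Doubling a positive number raises the floor of its binary logarithm by exactly one, which flips
-- the parity. Zero is excluded because it is its own double.
colourℕ-double-≢ : ∀ n .{{_ : NonZero n}} → colourℕ (n + n) ≢ colourℕ n
colourℕ-double-≢ n eq = opposite₂-≢ (colourℕ n) (begin
  opposite (colourℕ n)  ≡⟨ cong parity₂ (⌊log₂[2*b]⌋≡1+⌊log₂b⌋ n) ⟨
  colourℕ (2 * n)       ≡⟨ cong (λ m → colourℕ (n + m)) (+-identityʳ n) ⟩
  colourℕ (n + n)       ≡⟨ eq ⟩
  colourℕ n             ∎)
  where open ≡-Reasoning

module _ {κ : Cardinal ℓ} where

  open Cardinal κ using (Carrier; isStrictTotalOrder)
  open IsStrictTotalOrder isStrictTotalOrder using (_≟_)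
  open Setoid [ κ ]^<ω using (_≈_) renaming (refl to ≈-refl; sym to ≈-sym; trans to ≈-trans)

  -- The list witnessing finiteness may repeat elements, so it is deduplicated before its length is
  -- taken. Equality on `Carrier` is decidable by trichotomy of the well-order.
  enum : FinSubset κ → List Carrier
  enum S = deduplicate _≟_ (proj₁ (FinSubset.finite S))

  enum-! : ∀ S → Unique (enum S)
  enum-! S = DecUnique.deduplicate-! _≟_ (proj₁ (FinSubset.finite S))

  ∈-enum : ∀ S {α} → α ∈ elements S ⇔ α ∈ₗ enum S
  ∈-enum S {α} = deduplicate-∈⇔ _≟_ ⇔-∘ proj₂ (FinSubset.finite S) α

  size : FinSubset κ → ℕ
  size S = length (enum S)

  size-unique : ∀ S {xs} → Unique xs → (∀ {α} → α ∈ elements S ⇔ α ∈ₗ xs) → size S ≡ length xs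
  size-unique S xs! S⇔xs = unique-length-≡ (enum-! S) xs! (S⇔xs ⇔-∘ ⇔-sym (∈-enum S))

  size-cong : ∀ Y Z → Y ≈ Z → size Y ≡ size Z
  size-cong Y Z (Y⊆Z , Z⊆Y) = size-unique Y (enum-! Z) (∈-enum Z ⇔-∘ mk⇔ Y⊆Z Z⊆Y)

  size≡0⇒⊆ : ∀ (Y Z : FinSubset κ) → size Y ≡ 0 → elements Y ⊆ elements Z
  size≡0⇒⊆ Y Z |Y|≡0 α∈Y with enum Y | to (∈-enum Y) α∈Y
  -- An empty `enum Y` cannot contain `α`, and a nonempty one does not have length 0.
  size≡0⇒⊆ Y Z ()    α∈Y | _ ∷ _ | _

  elements-⊆? : ∀ Y Z → Dec (elements Y ⊆ elements Z)
  elements-⊆? Y Z = map′ {A = enum Y ⊆ₗ enum Z}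
    (λ p α∈Y → from (∈-enum Z) (p (to (∈-enum Y) α∈Y)))
    (λ p α∈Y → to (∈-enum Z) (p (from (∈-enum Y) α∈Y)))
    (enum Y ⊆? enum Z)
    where open DecSubset _≟_ using (_⊆?_) renaming (_⊆_ to _⊆ₗ_)

  -- `PairwiseDisjoint` gives information only from `¬ (Y ≈ Z)`, so injectivity of `size` is proved
  -- by contradiction. Decidability makes that argument constructive.
  _≈?_ : Decidable _≈_
  Y ≈? Z = elements-⊆? Y Z ×-dec elements-⊆? Z Y

  ∈-enum-++ : ∀ Y Z {α} → α ∈ elements Y ∪ elements Z ⇔ α ∈ₗ enum Y ++ enum Z
  ∈-enum-++ Y Z = mk⇔
    [ ∈-++⁺ˡ ∘ to (∈-enum Y) , ∈-++⁺ʳ (enum Y) ∘ to (∈-enum Z) ]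
    (map (from (∈-enum Y)) (from (∈-enum Z)) ∘ ∈-++⁻ (enum Y))

  _∪ᶠ_ : FinSubset κ → FinSubset κ → FinSubset κ
  Y ∪ᶠ Z = record
    { elements = elements Y ∪ elements Z
    ; finite   = enum Y ++ enum Z , λ _ → ∈-enum-++ Y Z
    }

  ∪ᶠ-idem : ∀ Y → Y ∪ᶠ Y ≈ Y
  ∪ᶠ-idem Y = [ (λ α∈Y → α∈Y) , (λ α∈Y → α∈Y) ] , inj₁

  -- Disjointness keeps the concatenation of the two enumerations repetition-free, so its length is
  -- the size of the union.
  size-∪ᶠ : ∀ Y Z → elements Y ⊥ elements Z → size (Y ∪ᶠ Z) ≡ size Y + size Z
  size-∪ᶠ Y Z Y⊥Z = trans
    (size-unique (Y ∪ᶠ Z)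
      (++⁺ (enum-! Y) (enum-! Z) λ (p , q) → Y⊥Z (from (∈-enum Y) p , from (∈-enum Z) q))
      (∈-enum-++ Y Z))
    (length-++ (enum Y))

  -- The subfamily with this union is `{Y, Z}`. The case where `Y` and `Z` coincide is also used: it
  -- colours the members of `X` themselves.
  ∪ᶠ∈FU : ∀ (X : Family κ) Y Z → Y ∈ members X → Z ∈ members X → Y ∪ᶠ Z ∈ FU X
  ∪ᶠ∈FU X Y Z Y∈X Z∈X =
      F
    , (λ { {W} (lift (inj₁ W≈Y)) → Family.respects X (≈-sym {W} {Y} W≈Y) Y∈X
         ; {W} (lift (inj₂ W≈Z)) → Family.respects X (≈-sym {W} {Z} W≈Z) Z∈X })
    , (Y ∷ Z ∷ []
      , λ _ → mk⇔ (λ { (lift (inj₁ W≈Y)) → here W≈Y ; (lift (inj₂ W≈Z)) → there (here W≈Z) })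
                  (λ { (here W≈Y) → lift (inj₁ W≈Y) ; (there (here W≈Z)) → lift (inj₂ W≈Z) }))
    , (Y , Y∈F)
    , λ _ → mk⇔ [ (λ α∈Y → Y , Y∈F , α∈Y) , (λ α∈Z → Z , Z∈F , α∈Z) ]
                (λ { (_ , lift (inj₁ (W⊆Y , _)) , α∈W) → inj₁ (W⊆Y α∈W)
                   ; (_ , lift (inj₂ (W⊆Z , _)) , α∈W) → inj₂ (W⊆Z α∈W) })
    where
    F : Family κ
    F = record
      -- Membership is stated up to `≈` so that `F` respects extensional equality; `Lift` only
      -- adjusts the universe level.
      { members  = λ W → Lift _ (W ≈ Y ⊎ W ≈ Z)
      ; respects = λ { {V} {W} V≈W (lift p) →
          let W≈V = ≈-sym {V} {W} V≈W in
          lift (map (≈-trans {W} {V} {Y} W≈V) (≈-trans {W} {V} {Z} W≈V) p) }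
      }
    Y∈F : Y ∈ members F
    Y∈F = lift (inj₁ (≈-refl {Y}))
    Z∈F : Z ∈ members F
    Z∈F = lift (inj₂ (≈-refl {Z}))

  colour : FinSubset κ → Fin 2
  colour S = colourℕ (size S)

  colour-cong : ∀ Y Z → Y ≈ Z → colour Y ≡ colour Z
  colour-cong Y Z Y≈Z = cong colourℕ (size-cong Y Z Y≈Z)

  colourPartition : Partition κ
  colourPartition = record
    { cell     = λ i → record
        { members  = λ S → Lift _ (colour S ≡ i)
        ; respects = λ { {Y} {Z} Y≈Z (lift eq) → lift (trans (sym (colour-cong Y Z Y≈Z)) eq) }
        }
    ; covers   = λ S → colour S , lift refl
    ; disjoint = λ { _ _ _ (lift p) (lift q) → trans (sym p) q }
    }

  colour-∪ᶠ-≢ : ∀ Y Z → size Y ≢ 0 → size Y ≡ size Z → elements Y ⊥ elements Z →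
                colour (Y ∪ᶠ Z) ≢ colour Y
  colour-∪ᶠ-≢ Y Z |Y|≢0 |Y|≡|Z| Y⊥Z eq =
    colourℕ-double-≢ (size Y) {{≢-nonZero |Y|≢0}} (begin
      colourℕ (size Y + size Y)  ≡⟨ cong (λ n → colourℕ (size Y + n)) |Y|≡|Z| ⟩
      colourℕ (size Y + size Z)  ≡⟨ cong colourℕ (size-∪ᶠ Y Z Y⊥Z) ⟨
      colour (Y ∪ᶠ Z)            ≡⟨ eq ⟩
      colour Y                   ∎)
    where open ≡-Reasoning

  monochromatic⇒countable : ∀ i (X : Family κ) → PairwiseDisjoint X →
                            FU X ⊆ members (cell colourPartition i) → Countable ⟦ X ⟧
  monochromatic⇒countable i X disjoint mono = record
    { to        = size ∘ proj₁
    ; cong      = λ {(Y , _)} {(Z , _)} → size-cong Y Z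
    ; injective = λ {Y} {Z} → size-injective Y Z
    }
    where
    colour-∪ᶠ : ∀ Y Z → Y ∈ members X → Z ∈ members X → colour (Y ∪ᶠ Z) ≡ i
    colour-∪ᶠ Y Z Y∈X Z∈X = lower (mono {Y ∪ᶠ Z} (∪ᶠ∈FU X Y Z Y∈X Z∈X))

    size-injective : ((Y , _) (Z , _) : Setoid.Carrier ⟦ X ⟧) → size Y ≡ size Z → Y ≈ Z
    size-injective (Y , Y∈X) (Z , Z∈X) |Y|≡|Z| = decidable-stable (Y ≈? Z) λ Y≉Z →
      colour-∪ᶠ-≢ Y Z
        -- If the common size were 0, both sets would be empty and hence equal. So `X` may contain
        -- the empty set without harming injectivity.
        (λ |Y|≡0 → Y≉Z (size≡0⇒⊆ Y Z |Y|≡0 , size≡0⇒⊆ Z Y (trans (sym |Y|≡|Z|) |Y|≡0)))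
        |Y|≡|Z|
        (disjoint Y Z Y∈X Z∈X Y≉Z)
        -- `Y ∪ᶠ Z` has colour `i`, and so does `Y`, since it equals the finite union `Y ∪ᶠ Y`.
        (trans (colour-∪ᶠ Y Z Y∈X Z∈X)
          (trans (sym (colour-∪ᶠ Y Y Y∈X Y∈X)) (colour-cong (Y ∪ᶠ Y) Y (∪ᶠ-idem Y))))

theorem2p1 : ∀ {ℓ} →
    ((κ : Cardinal ℓ) → Infinite ∣ κ ∣ →
    Σ[ A ∈ Partition κ ]
    ((i : Fin 2) (X : Family κ) → Uncountable ⟦ X ⟧ → PairwiseDisjoint X →
    ¬ (FU X ⊆ members (cell A i))))
    ×
    ((μ κ : Cardinal ℓ) → Uncountable ∣ μ ∣ → μ ≤ᶜ κ → ¬ Hind κ μ)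
theorem2p1 =
    (λ _ _ → colourPartition , λ i X uncountable disjoint mono →
      uncountable (monochromatic⇒countable i X disjoint (λ {S} → mono {S})))
  , λ _ _ uncountable _ hind →
      -- The same partition refutes `Hind`: the bijection from `μ` onto `X` followed by the
      -- injection of `X` into the naturals would make `μ` countable.
      let X , μ⤖X , disjoint , i , mono = hind colourPartition in
      uncountable (injection (Bijection.injection μ⤖X) (monochromatic⇒countable i X disjoint (λ {S} → mono {S})))
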